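{- Let $\Psi$ be any set of $\mathcal{L}_\bullet$-sequents. If for every sequent $\chi\vdash\delta\in\Psi$ each propositional variable in $\chi$ occurs only once in $\chi$, then the rule $$\frac{\Delta\vdash\phi\qquad \Gamma[\phi]\cdots[\phi]\vdash\psi}{\Gamma[\Delta]\cdots[\Delta]\vdash\psi}\ (\mathrm{mix})$$ is admissible in $\mathsf{G_{BDFNL}}(\odot\Psi)$, where $\Gamma[-]\cdots[-]$ is a context with one or more holes.
   Context: $\mathcal{L}_{\mathrm{LC}}$-formulas are built from propositional variables and $\top,\bot$ using $\wedge,\vee,\to,\bullet,\leftarrow$; $\mathcal{L}_\bullet$-formulas are built from propositional variables and $\top,\bot$ using only $\bullet$; an $\mathcal{L}_\bullet$-sequent is $\chi\vdash\delta$ with $\chi,\delta$ $\mathcal{L}_\bullet$-formulas. Structures: $\Gamma::=\phi\mid(\Gamma\odot\Gamma)\mid(\Gamma\barwedge\Gamma)$ with $\phi$ an $\mathcal{L}_{\mathrm{LC}}$-formula. A consecution is $\Gamma\vdash\phi$ with $\Gamma$ a structure and $\phi$ an $\mathcal{L}_{\mathrm{LC}}$-formula. A context $\Gamma[-]$ is a structure with a hole, and $\Gamma[\Delta]$ is the result of filling the hole with the structure $\Delta$ (similarly for several holes). A rule is admissible in a calculus if its conclusion is derivable whenever its premisses are. $\mathsf{G_{BDFNL}}$ has: Axioms: $\phi\vdash\phi$; $\Gamma\vdash\top$; $\Gamma[\bot]\vdash\phi$. Logical rules: from $\Delta\vdash\phi$ and $\Gamma[\psi]\vdash\gamma$ infer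 $\Gamma[\Delta\odot(\phi\to\psi)]\vdash\gamma$; from $\phi\odot\Gamma\vdash\psi$ infer $\Gamma\vdash\phi\to\psi$; from $\Gamma[\phi]\vdash\gamma$ and $\Delta\vdash\psi$ infer $\Gamma[(\phi\leftarrow\psi)\odot\Delta]\vdash\gamma$; from $\Gamma\odot\psi\vdash\phi$ infer $\Gamma\vdash\phi\leftarrow\psi$; from $\Gamma[\phi\odot\psi]\vdash\gamma$ infer $\Gamma[\phi\bullet\psi]\vdash\gamma$; from $\Gamma\vdash\phi$ and $\Delta\vdash\psi$ infer $\Gamma\odot\Delta\vdash\phi\bullet\psi$; from $\Gamma[\phi\barwedge\psi]\vdash\gamma$ infer $\Gamma[\phi\wedge\psi]\vdash\gamma$; from $\Gamma\vdash\phi$ and $\Delta\vdash\psi$ infer $\Gamma\barwedge\Delta\vdash\phi\wedge\psi$; from $\Gamma[\phi]\vdash\gamma$ and $\Gamma[\psi]\vdash\gamma$ infer $\Gamma[\phi\vee\psi]\vdash\gamma$; from $\Gamma\vdash\phi_i$ infer $\Gamma\vdash\phi_1\vee\phi_2$ ($i=1,2$). Structural rules: from $\Gamma[\Delta\barwedge\Delta]\vdash\phi$ infer $\Gamma[\Delta]\vdash\phi$; from $\Gamma[\Delta]\vdash\phi$ infer $\Gamma[\Sigma\barwedge\Delta]\vdash\phi$; from $\Gamma[\Delta\barwedge\Lambda]\vdash\phi$ infer $\Gamma[\Lambda\barwedge\Delta]\vdash\phi$; from $\Gamma[(\Delta_1\barwedge\Delta_2)\barwedge\Delta_3]\vdash\phi$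 infer $\Gamma[\Delta_1\barwedge(\Delta_2\barwedge\Delta_3)]\vdash\phi$. For an $\mathcal{L}_\bullet$-sequent $(\sigma)\ \chi\vdash\delta$ with propositional variables among $p_1,\dots,p_n$, the structural rule $(\odot\sigma)$ is: from $\Gamma[\delta[\Delta_1/p_1,\dots,\Delta_n/p_n]]\vdash\phi$ infer $\Gamma[\chi[\Delta_1/p_1,\dots,\Delta_n/p_n]]\vdash\phi$, where $\Delta_1,\dots,\Delta_n$ are arbitrary structures and $\delta[\Delta_1/p_1,\dots]$, $\chi[\Delta_1/p_1,\dots]$ are the structures obtained by uniformly substituting $\Delta_i$ for $p_i$ and $\odot$ for $\bullet$. $\mathsf{G_{BDFNL}}(\odot\Psi)$ is $\mathsf{G_{BDFNL}}$ extended with the rules $(\odot\sigma)$ for all $\sigma\in\Psi$.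
   Formalization: The formal theorem additionally assumes that the constant ⊤ does not occur in χ for any χ ⊢ δ in Ψ; without this the claim fails: for Ψ = {⊤ ⊢ ⊥}, q ⊢ ⊤ and ⊤ ⊢ p are derivable, but q ⊢ p is not. -}

module Defs where

open import Data.List using (List; []; _∷_; _++_)
open import Data.List.Relation.Unary.AllPairs using (module AllPairs)
open import Data.List.Relation.Unary.Unique.Propositional using (Unique)
open import Data.Nat using (ℕ; _+_; _≤_; s≤s; z≤n)
open import Data.Product using (_×_; _,_)
open import Level using (Level; 0ℓ)
open import Relation.Binary.PropositionalEquality using (_≡_; refl)
open import Relation.Nullary using (¬_)
open import Relation.Unary using (Pred)

infixr 30 _•_ _∧_
infixr 29 _∨_
infixr 28 _⇒_
infixl 28 _⇐_
infixl 25 _⊙_ _⊼_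
infix  40 _[_] _⟦_⟧
infix  10 _∣_⊢_ _⊢•_

data Formula : Set where
  var     : ℕ → Formula
  top bot : Formula
  _∧_ _∨_ _⇒_ _•_ _⇐_ : Formula → Formula → Formula

data Formula• : Set where
  var     : ℕ → Formula•
  top bot : Formula•
  _•_     : Formula• → Formula• → Formula•

record Sequent• : Set where
  constructor _⊢•_
  field
    ant suc : Formula•

open Sequent• public

data Structure : Set where
  ⌜_⌝     : Formula → Structure
  _⊙_ _⊼_ : Structure → Structure → Structure

data Context : Set where
  □         : Context
  _⊙ˡ_ _⊼ˡ_ : Context → Structure → Context
  _⊙ʳ_ _⊼ʳ_ : Structure → Context → Context

_[_] : Context → Structure → Structure
□        [ Θ ] = Θ
(Γ ⊙ˡ Δ) [ Θ ] = Γ [ Θ ] ⊙ Δ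
(Γ ⊼ˡ Δ) [ Θ ] = Γ [ Θ ] ⊼ Δ
(Δ ⊙ʳ Γ) [ Θ ] = Δ ⊙ Γ [ Θ ]
(Δ ⊼ʳ Γ) [ Θ ] = Δ ⊼ Γ [ Θ ]

-- Any number of holes, possibly none: `1 ≤ holes Γ` is required where needed.
data MultiContext : Set where
  □       : MultiContext
  ⌜_⌝     : Formula → MultiContext
  _⊙_ _⊼_ : MultiContext → MultiContext → MultiContext

holes : MultiContext → ℕ
holes □       = 1
holes ⌜ _ ⌝   = 0
holes (Γ ⊙ Δ) = holes Γ + holes Δ
holes (Γ ⊼ Δ) = holes Γ + holes Δ

-- Every hole receives the same structure.
_⟦_⟧ : MultiContext → Structure → Structure
□       ⟦ Θ ⟧ = Θ
⌜ φ ⌝   ⟦ Θ ⟧ = ⌜ φ ⌝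
(Γ ⊙ Δ) ⟦ Θ ⟧ = Γ ⟦ Θ ⟧ ⊙ Δ ⟦ Θ ⟧
(Γ ⊼ Δ) ⟦ Θ ⟧ = Γ ⟦ Θ ⟧ ⊼ Δ ⟦ Θ ⟧

-- χ [Δ₁/p₁, …]: structures for variables, ⊙ for •; constants stay as they are.
substitute : Formula• → (ℕ → Structure) → Structure
substitute (var p) Δ = Δ p
substitute top     Δ = ⌜ top ⌝
substitute bot     Δ = ⌜ bot ⌝
substitute (χ • δ) Δ = substitute χ Δ ⊙ substitute δ Δ

-- Derivability in G_BDFNL(⊙Ψ).
data _∣_⊢_ {ℓ : Level} (Ψ : Pred Sequent• ℓ) : Structure → Formula → Set ℓ where

  ax : ∀ {φ} → Ψ ∣ ⌜ φ ⌝ ⊢ φ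
  ⊤R : ∀ {Γ} → Ψ ∣ Γ ⊢ top
  ⊥L : ∀ Γ {φ} → Ψ ∣ Γ [ ⌜ bot ⌝ ] ⊢ φ

  ⇒L : ∀ Γ {Δ φ ψ γ} → Ψ ∣ Δ ⊢ φ → Ψ ∣ Γ [ ⌜ ψ ⌝ ] ⊢ γ →
       Ψ ∣ Γ [ Δ ⊙ ⌜ φ ⇒ ψ ⌝ ] ⊢ γ
  ⇒R : ∀ {Γ φ ψ} → Ψ ∣ ⌜ φ ⌝ ⊙ Γ ⊢ ψ → Ψ ∣ Γ ⊢ φ ⇒ ψ

  ⇐L : ∀ Γ {Δ φ ψ γ} → Ψ ∣ Γ [ ⌜ φ ⌝ ] ⊢ γ → Ψ ∣ Δ ⊢ ψ →
       Ψ ∣ Γ [ ⌜ φ ⇐ ψ ⌝ ⊙ Δ ] ⊢ γ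
  ⇐R : ∀ {Γ φ ψ} → Ψ ∣ Γ ⊙ ⌜ ψ ⌝ ⊢ φ → Ψ ∣ Γ ⊢ φ ⇐ ψ

  •L : ∀ Γ {φ ψ γ} → Ψ ∣ Γ [ ⌜ φ ⌝ ⊙ ⌜ ψ ⌝ ] ⊢ γ → Ψ ∣ Γ [ ⌜ φ • ψ ⌝ ] ⊢ γ
  •R : ∀ {Γ Δ φ ψ} → Ψ ∣ Γ ⊢ φ → Ψ ∣ Δ ⊢ ψ → Ψ ∣ Γ ⊙ Δ ⊢ φ • ψ

  ∧L : ∀ Γ {φ ψ γ} → Ψ ∣ Γ [ ⌜ φ ⌝ ⊼ ⌜ ψ ⌝ ] ⊢ γ → Ψ ∣ Γ [ ⌜ φ ∧ ψ ⌝ ] ⊢ γ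
  ∧R : ∀ {Γ Δ φ ψ} → Ψ ∣ Γ ⊢ φ → Ψ ∣ Δ ⊢ ψ → Ψ ∣ Γ ⊼ Δ ⊢ φ ∧ ψ

  ∨L  : ∀ Γ {φ ψ γ} → Ψ ∣ Γ [ ⌜ φ ⌝ ] ⊢ γ → Ψ ∣ Γ [ ⌜ ψ ⌝ ] ⊢ γ →
        Ψ ∣ Γ [ ⌜ φ ∨ ψ ⌝ ] ⊢ γ
  ∨R₁ : ∀ {Γ φ ψ} → Ψ ∣ Γ ⊢ φ → Ψ ∣ Γ ⊢ φ ∨ ψ
  ∨R₂ : ∀ {Γ φ ψ} → Ψ ∣ Γ ⊢ ψ → Ψ ∣ Γ ⊢ φ ∨ ψ

  ⊼-contract : ∀ Γ {Δ φ} → Ψ ∣ Γ [ Δ ⊼ Δ ] ⊢ φ → Ψ ∣ Γ [ Δ ] ⊢ φ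
  ⊼-weaken   : ∀ Γ {Δ Σ φ} → Ψ ∣ Γ [ Δ ] ⊢ φ → Ψ ∣ Γ [ Σ ⊼ Δ ] ⊢ φ
  ⊼-exchange : ∀ Γ {Δ Λ φ} → Ψ ∣ Γ [ Δ ⊼ Λ ] ⊢ φ → Ψ ∣ Γ [ Λ ⊼ Δ ] ⊢ φ
  ⊼-assoc    : ∀ Γ {Δ₁ Δ₂ Δ₃ φ} → Ψ ∣ Γ [ (Δ₁ ⊼ Δ₂) ⊼ Δ₃ ] ⊢ φ →
               Ψ ∣ Γ [ Δ₁ ⊼ (Δ₂ ⊼ Δ₃) ] ⊢ φ

  ⊙σ : ∀ Γ {σ φ} → Ψ σ → (Δ : ℕ → Structure) →
       Ψ ∣ Γ [ substitute (suc σ) Δ ] ⊢ φ → Ψ ∣ Γ [ substitute (ant σ) Δ ] ⊢ φ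

MixAdmissible : {ℓ : Level} → Pred Sequent• ℓ → Set ℓ
MixAdmissible Ψ = ∀ Γ Δ φ ψ → 1 ≤ holes Γ →
  Ψ ∣ Δ ⊢ φ → Ψ ∣ Γ ⟦ ⌜ φ ⌝ ⟧ ⊢ ψ → Ψ ∣ Γ ⟦ Δ ⟧ ⊢ ψ

vars : Formula• → List ℕ
vars (var p) = p ∷ []
vars top     = []
vars bot     = []
vars (χ • δ) = vars χ ++ vars δ

Linear : Formula• → Set
Linear χ = Unique (vars χ)

data TopFree : Formula• → Set where
  var : ∀ p → TopFree (var p)
  bot : TopFree bot
  _•_ : ∀ {χ δ} → TopFree χ → TopFree δ → TopFree (χ • δ)

-- Linearity of the antecedents alone does not make mix admissible. For
-- Ψ = {⊤ ⊢ ⊥}, q ⊢ ⊤ is an axiom and ⊤ ⊢ p follows from ⊥ ⊢ p by (⊙σ), but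
-- q ⊢ p is underivable: (⊙σ) needs a literal ⊤ on the left. This is why
-- TopFree is needed.
module LinearityInsufficient where

  Ψ₀ : Pred Sequent• 0ℓ
  Ψ₀ σ = σ ≡ (top ⊢• bot)

  OnlyQ : Structure → Set
  OnlyQ ⌜ φ ⌝   = φ ≡ var 1
  OnlyQ (Γ ⊙ Δ) = OnlyQ Γ × OnlyQ Δ
  OnlyQ (Γ ⊼ Δ) = OnlyQ Γ × OnlyQ Δ

  plugged : ∀ Γ {Θ} → OnlyQ (Γ [ Θ ]) → OnlyQ Θ
  plugged □        o       = o
  plugged (Γ ⊙ˡ Δ) (o , _) = plugged Γ o
  plugged (Γ ⊼ˡ Δ) (o , _) = plugged Γ o
  plugged (Δ ⊙ʳ Γ) (_ , o) = plugged Γ o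
  plugged (Δ ⊼ʳ Γ) (_ , o) = plugged Γ o

  replug : ∀ Γ {Θ Ξ} → (OnlyQ Θ → OnlyQ Ξ) → OnlyQ (Γ [ Θ ]) → OnlyQ (Γ [ Ξ ])
  replug □        f o       = f o
  replug (Γ ⊙ˡ Δ) f (o , d) = replug Γ f o , d
  replug (Γ ⊼ˡ Δ) f (o , d) = replug Γ f o , d
  replug (Δ ⊙ʳ Γ) f (d , o) = d , replug Γ f o
  replug (Δ ⊼ʳ Γ) f (d , o) = d , replug Γ f o

  underivable : ∀ {Γ} → OnlyQ Γ → ¬ (Ψ₀ ∣ Γ ⊢ var 0)
  underivable () ax
  underivable o (⊥L Γ) with () ← plugged Γ o
  underivable o (⇒L Γ _ _) with _ , () ← plugged Γ o
  underivable o (⇐L Γ _ _) with () , _ ← plugged Γ o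
  underivable o (•L Γ _) with () ← plugged Γ o
  underivable o (∧L Γ _) with () ← plugged Γ o
  underivable o (∨L Γ _ _) with () ← plugged Γ o
  underivable o (⊼-contract Γ d) = underivable (replug Γ (λ x → x , x) o) d
  underivable o (⊼-weaken Γ d) = underivable (replug Γ (λ (_ , x) → x) o) d
  underivable o (⊼-exchange Γ d) = underivable (replug Γ (λ (x , y) → y , x) o) d
  underivable o (⊼-assoc Γ d) =
    underivable (replug Γ (λ (x , y , z) → (x , y) , z) o) d
  underivable o (⊙σ Γ refl _ _) with () ← plugged Γ o

  linearity-insufficient :
    ¬ ((Ψ : Pred Sequent• 0ℓ) → (∀ σ → Ψ σ → Linear (ant σ)) → MixAdmissible Ψ)
  linearity-insufficient mix = underivable refl
    (mix Ψ₀ linear □ ⌜ var 1 ⌝ top (var 0) (s≤s z≤n) ⊤R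
      (⊙σ □ refl (λ p → ⌜ var p ⌝) (⊥L □)))
    where
    linear : ∀ σ → Ψ₀ σ → Linear (ant σ)
    linear _ refl = AllPairs.[]

{-# OPTIONS --safe #-}
module Submission where

-- Mix is eliminated by a main induction on the mix formula φ, with an inner
-- induction on the derivation of the right premise. Occurrences of φ are
-- traced upwards by the relation Γ ⇝ Γ′, which replaces any set of leaves φ of
-- Γ by structures deriving φ, not necessarily all the same one. It commutes
-- with plugging (`unplug`), so it passes through contraction, which is why
-- several occurrences must be replaced at once.
--
-- When an occurrence of φ is principal in a left rule, the inner induction
-- first replaces all the other occurrences. One occurrence then remains, and
-- `left-commute` moves it up the derivation of the left premise Δ ⊢ φ to the
-- places where φ is introduced on the right, or to an identity axiom. In the
-- first case the mix is traded for mixes on immediate subformulas of φ, in the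
-- second the left rule is simply applied again.
--
-- The critical structural rule is (⊙σ) with σ = χ ⊢ δ. Linearity of χ makes
-- every replacement inside χ[Δ₁/p₁, …] a replacement inside the Δᵢ: otherwise
-- two copies of one Δᵢ could be replaced differently (`⇝-substitute`). The
-- constants of χ are literal leaves: ⊤ is excluded by hypothesis, as the
-- axiom Γ ⊢ ⊤ would allow anything in its place; and if a leaf ⊥, here or in
-- the axiom Γ[⊥] ⊢ φ, is replaced by some Θ ⊢ ⊥, the conclusion holds outright,
-- since such a Θ derives everything in every context (`absurd`).

open import Defs
open import Data.List using (List; []; _∷_; _++_)
open import Data.List.Membership.Propositional using (_∈_)
open import Data.List.Membership.Propositional.Properties using (∈-++⁺ˡ; ∈-++⁺ʳ)
open import Data.List.Relation.Unary.All as All using (All; []; _∷_)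
import Data.List.Relation.Unary.All.Properties as All
open import Data.List.Relation.Unary.AllPairs using (AllPairs; []; _∷_)
open import Data.List.Relation.Unary.Any using (here)
open import Data.Nat using (ℕ; _≟_)
open import Data.List.Membership.DecPropositional _≟_ using (_∈?_)
open import Data.Product using (∃-syntax; _×_; _,_)
open import Data.Sum using (_⊎_; inj₁; inj₂)
open import Data.Unit.Polymorphic using (⊤; tt)
open import Level using (Level)
open import Relation.Binary using (Rel)
open import Relation.Binary.PropositionalEquality
  using (_≡_; _≢_; refl; sym; cong; cong₂; subst)
open import Relation.Nullary using (yes; no; contradiction)
open import Relation.Unary using (Pred)

-- Composition of contexts

-- C ∘ D fills the hole of C with D.
_∘_ : Context → Context → Context
□        ∘ D = D
(C ⊙ˡ Δ) ∘ D = (C ∘ D) ⊙ˡ Δ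
(C ⊼ˡ Δ) ∘ D = (C ∘ D) ⊼ˡ Δ
(Δ ⊙ʳ C) ∘ D = Δ ⊙ʳ (C ∘ D)
(Δ ⊼ʳ C) ∘ D = Δ ⊼ʳ (C ∘ D)

[]-∘ : ∀ C D Θ → (C ∘ D) [ Θ ] ≡ C [ D [ Θ ] ]
[]-∘ □        D Θ = refl
[]-∘ (C ⊙ˡ Δ) D Θ = cong (_⊙ Δ) ([]-∘ C D Θ)
[]-∘ (C ⊼ˡ Δ) D Θ = cong (_⊼ Δ) ([]-∘ C D Θ)
[]-∘ (Δ ⊙ʳ C) D Θ = cong (Δ ⊙_) ([]-∘ C D Θ)
[]-∘ (Δ ⊼ʳ C) D Θ = cong (Δ ⊼_) ([]-∘ C D Θ)

-- Substitution of structures, and linearity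

AllPairs-++⁻ : ∀ {a r} {A : Set a} {R : Rel A r} (xs : List A) {ys : List A} →
  AllPairs R (xs ++ ys) →
  AllPairs R xs × AllPairs R ys × All (λ x → All (R x) ys) xs
AllPairs-++⁻ []       rs       = [] , rs , []
AllPairs-++⁻ (x ∷ xs) (r ∷ rs) with AllPairs-++⁻ xs rs
... | rxs , rys , rxys =
  All.++⁻ˡ xs r ∷ rxs , rys , All.++⁻ʳ xs r ∷ rxys

substitute-cong : ∀ χ {Δ Δ′ : ℕ → Structure} →
  (∀ {p} → p ∈ vars χ → Δ p ≡ Δ′ p) → substitute χ Δ ≡ substitute χ Δ′
substitute-cong (var p) eq = eq (here refl)
substitute-cong top     eq = refl
substitute-cong bot     eq = refl
substitute-cong (χ • δ) eq = cong₂ _⊙_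
  (substitute-cong χ λ i → eq (∈-++⁺ˡ i))
  (substitute-cong δ λ i → eq (∈-++⁺ʳ (vars χ) i))

-- The substitution that agrees with Δ on ps and with Δ′ elsewhere.
glue : List ℕ → (Δ Δ′ : ℕ → Structure) → ℕ → Structure
glue ps Δ Δ′ p with p ∈? ps
... | yes _ = Δ p
... | no  _ = Δ′ p

glue-∈ : ∀ {ps Δ Δ′ p} → p ∈ ps → Δ p ≡ glue ps Δ Δ′ p
glue-∈ {ps} {p = p} i with p ∈? ps
... | yes _ = refl
... | no ¬i = contradiction i ¬i

glue-disjoint : ∀ {ps qs Δ Δ′ p} → All (λ x → All (x ≢_) qs) ps →
  p ∈ qs → Δ′ p ≡ glue ps Δ Δ′ p
glue-disjoint {ps} {p = p} ps#qs j with p ∈? ps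
... | yes i = contradiction refl (All.lookup (All.lookup ps#qs i) j)
... | no  _ = refl

module _ {ℓ : Level} (Ψ : Pred Sequent• ℓ) where

  private variable
    Γ Γ′ Δ Δ′ Θ : Structure
    φ ψ : Formula

  ∘-intro : ∀ C D → Ψ ∣ C [ D [ Θ ] ] ⊢ ψ → Ψ ∣ (C ∘ D) [ Θ ] ⊢ ψ
  ∘-intro C D = subst (Ψ ∣_⊢ _) (sym ([]-∘ C D _))

  ∘-elim : ∀ C D → Ψ ∣ (C ∘ D) [ Θ ] ⊢ ψ → Ψ ∣ C [ D [ Θ ] ] ⊢ ψ
  ∘-elim C D = subst (Ψ ∣_⊢ _) ([]-∘ C D _)

  -- Moving a mix up the left premise

  -- Derivations of Δ ⊢ φ that are an axiom φ ⊢ φ or Δ ⊢ ⊤, or end with a right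
  -- rule.
  data RightIntro : Structure → Formula → Set ℓ where
    ax  : RightIntro ⌜ φ ⌝ φ
    ⊤R  : RightIntro Γ top
    ⇒R  : Ψ ∣ ⌜ φ ⌝ ⊙ Γ ⊢ ψ → RightIntro Γ (φ ⇒ ψ)
    ⇐R  : Ψ ∣ Γ ⊙ ⌜ ψ ⌝ ⊢ φ → RightIntro Γ (φ ⇐ ψ)
    •R  : Ψ ∣ Γ ⊢ φ → Ψ ∣ Δ ⊢ ψ → RightIntro (Γ ⊙ Δ) (φ • ψ)
    ∧R  : Ψ ∣ Γ ⊢ φ → Ψ ∣ Δ ⊢ ψ → RightIntro (Γ ⊼ Δ) (φ ∧ ψ)
    ∨R₁ : Ψ ∣ Γ ⊢ φ → RightIntro Γ (φ ∨ ψ)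
    ∨R₂ : Ψ ∣ Γ ⊢ ψ → RightIntro Γ (φ ∨ ψ)

  -- The rules not listed in RightIntro act on the left only, so they can be applied
  -- inside C.
  left-commute : ∀ C → (∀ {Δ} → RightIntro Δ φ → Ψ ∣ C [ Δ ] ⊢ ψ) →
    Ψ ∣ Δ ⊢ φ → Ψ ∣ C [ Δ ] ⊢ ψ
  left-commute C k ax        = k ax
  left-commute C k ⊤R        = k ⊤R
  left-commute C k (⇒R d)    = k (⇒R d)
  left-commute C k (⇐R d)    = k (⇐R d)
  left-commute C k (•R d e)  = k (•R d e)
  left-commute C k (∧R d e)  = k (∧R d e)
  left-commute C k (∨R₁ d)   = k (∨R₁ d)
  left-commute C k (∨R₂ d)   = k (∨R₂ d)
  left-commute C k (⊥L Γ)    = ∘-elim C Γ (⊥L (C ∘ Γ))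
  left-commute C k (⇒L Γ d e) =
    ∘-elim C Γ (⇒L (C ∘ Γ) d (∘-intro C Γ (left-commute C k e)))
  left-commute C k (⇐L Γ d e) =
    ∘-elim C Γ (⇐L (C ∘ Γ) (∘-intro C Γ (left-commute C k d)) e)
  left-commute C k (•L Γ d) =
    ∘-elim C Γ (•L (C ∘ Γ) (∘-intro C Γ (left-commute C k d)))
  left-commute C k (∧L Γ d) =
    ∘-elim C Γ (∧L (C ∘ Γ) (∘-intro C Γ (left-commute C k d)))
  left-commute C k (∨L Γ d e) =
    ∘-elim C Γ (∨L (C ∘ Γ) (∘-intro C Γ (left-commute C k d))
                           (∘-intro C Γ (left-commute C k e)))
  left-commute C k (⊼-contract Γ d) =
    ∘-elim C Γ (⊼-contract (C ∘ Γ) (∘-intro C Γ (left-commute C k d)))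
  left-commute C k (⊼-weaken Γ d) =
    ∘-elim C Γ (⊼-weaken (C ∘ Γ) (∘-intro C Γ (left-commute C k d)))
  left-commute C k (⊼-exchange Γ d) =
    ∘-elim C Γ (⊼-exchange (C ∘ Γ) (∘-intro C Γ (left-commute C k d)))
  left-commute C k (⊼-assoc Γ d) =
    ∘-elim C Γ (⊼-assoc (C ∘ Γ) (∘-intro C Γ (left-commute C k d)))
  left-commute C k (⊙σ Γ σ Δ d) =
    ∘-elim C Γ (⊙σ (C ∘ Γ) σ Δ (∘-intro C Γ (left-commute C k d)))

  left-commute-∘ : ∀ C D → (∀ {Δ} → RightIntro Δ φ → Ψ ∣ C [ D [ Δ ] ] ⊢ ψ) →
    Ψ ∣ Δ ⊢ φ → Ψ ∣ C [ D [ Δ ] ] ⊢ ψ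
  left-commute-∘ C D k d =
    ∘-elim C D (left-commute (C ∘ D) (λ i → ∘-intro C D (k i)) d)

  -- Nothing introduces ⊥ on the right but the identity axiom.
  absurd : ∀ C → Ψ ∣ Δ ⊢ bot → Ψ ∣ C [ Δ ] ⊢ ψ
  absurd C = left-commute C λ { ax → ⊥L C }

  -- Replacing occurrences of the mix formula

  -- Γ ⇝⟨ φ ⟩ Γ′: some leaves φ of Γ, possibly none, are replaced in Γ′ by
  -- structures that derive φ.
  infix 10 _⇝⟨_⟩_
  data _⇝⟨_⟩_ : Structure → Formula → Structure → Set ℓ where
    hit  : Ψ ∣ Δ ⊢ φ → ⌜ φ ⌝ ⇝⟨ φ ⟩ Δ
    keep : ⌜ ψ ⌝ ⇝⟨ φ ⟩ ⌜ ψ ⌝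
    _⊙_  : Γ ⇝⟨ φ ⟩ Γ′ → Δ ⇝⟨ φ ⟩ Δ′ → (Γ ⊙ Δ) ⇝⟨ φ ⟩ (Γ′ ⊙ Δ′)
    _⊼_  : Γ ⇝⟨ φ ⟩ Γ′ → Δ ⇝⟨ φ ⟩ Δ′ → (Γ ⊼ Δ) ⇝⟨ φ ⟩ (Γ′ ⊼ Δ′)

  ⇝-refl : Γ ⇝⟨ φ ⟩ Γ
  ⇝-refl {Γ = ⌜ _ ⌝} = keep
  ⇝-refl {Γ = Γ ⊙ Δ} = ⇝-refl ⊙ ⇝-refl
  ⇝-refl {Γ = Γ ⊼ Δ} = ⇝-refl ⊼ ⇝-refl

  ⇝-plug : ∀ C → Γ ⇝⟨ φ ⟩ Γ′ → C [ Γ ] ⇝⟨ φ ⟩ C [ Γ′ ]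
  ⇝-plug □        r = r
  ⇝-plug (C ⊙ˡ Δ) r = ⇝-plug C r ⊙ ⇝-refl
  ⇝-plug (C ⊼ˡ Δ) r = ⇝-plug C r ⊼ ⇝-refl
  ⇝-plug (Δ ⊙ʳ C) r = ⇝-refl ⊙ ⇝-plug C r
  ⇝-plug (Δ ⊼ʳ C) r = ⇝-refl ⊼ ⇝-plug C r

  ⇝-fill : ∀ M → Ψ ∣ Δ ⊢ φ → M ⟦ ⌜ φ ⌝ ⟧ ⇝⟨ φ ⟩ M ⟦ Δ ⟧
  ⇝-fill □       d = hit d
  ⇝-fill ⌜ _ ⌝   d = keep
  ⇝-fill (M ⊙ N) d = ⇝-fill M d ⊙ ⇝-fill N d
  ⇝-fill (M ⊼ N) d = ⇝-fill M d ⊼ ⇝-fill N d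

  -- View of a replacement in C [ Θ ] as one in C and one in Θ. The
  -- replacement in C is given by its action on every filling.
  data Unplugged (φ : Formula) (C : Context) (Θ : Structure) :
      Structure → Set ℓ where
    plugged : ∀ C′ {Θ′} → (∀ {Δ Δ′} → Δ ⇝⟨ φ ⟩ Δ′ → C [ Δ ] ⇝⟨ φ ⟩ C′ [ Δ′ ]) →
      Θ ⇝⟨ φ ⟩ Θ′ → Unplugged φ C Θ (C′ [ Θ′ ])

  unplug : ∀ C → C [ Θ ] ⇝⟨ φ ⟩ Γ′ → Unplugged φ C Θ Γ′
  unplug □ r = plugged □ (λ s → s) r
  unplug (C ⊙ˡ Δ) (r ⊙ t) with unplug C r
  ... | plugged C′ c q = plugged (C′ ⊙ˡ _) (λ s → c s ⊙ t) q
  unplug (C ⊼ˡ Δ) (r ⊼ t) with unplug C r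
  ... | plugged C′ c q = plugged (C′ ⊼ˡ _) (λ s → c s ⊼ t) q
  unplug (Δ ⊙ʳ C) (t ⊙ r) with unplug C r
  ... | plugged C′ c q = plugged (_ ⊙ʳ C′) (λ s → t ⊙ c s) q
  unplug (Δ ⊼ʳ C) (t ⊼ r) with unplug C r
  ... | plugged C′ c q = plugged (_ ⊼ʳ C′) (λ s → t ⊼ c s) q

  -- A replacement in χ[Δ₁/p₁, …] comes from replacements in the Δᵢ, glued along
  -- the disjoint variable sets of the two sides of each •. The second
  -- alternative arises when a leaf ⊥ of χ itself is replaced.
  ⇝-substitute : ∀ {χ} → Linear χ → TopFree χ → (Δ : ℕ → Structure) →
    substitute χ Δ ⇝⟨ φ ⟩ Γ′ →
    (∃[ Δ′ ] (∀ p → Δ p ⇝⟨ φ ⟩ Δ′ p) × Γ′ ≡ substitute χ Δ′) ⊎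
    (∃[ C ] ∃[ Θ ] (Ψ ∣ Θ ⊢ bot) × Γ′ ≡ C [ Θ ])
  ⇝-substitute {φ} {Γ′} _ (var p) Δ r = inj₁ (Ξ , Δ⇝Ξ , Γ′≡)
    where
    Ξ : ℕ → Structure
    Ξ = glue (p ∷ []) (λ _ → Γ′) Δ

    Δ⇝Ξ : ∀ q → Δ q ⇝⟨ φ ⟩ Ξ q
    Δ⇝Ξ q with q ∈? (p ∷ [])
    ... | yes (here refl) = r
    ... | no _ = ⇝-refl

    Γ′≡ : Γ′ ≡ Ξ p
    Γ′≡ = glue-∈ {p ∷ []} {λ _ → Γ′} {Δ} (here refl)
  ⇝-substitute _ bot Δ (hit d) = inj₂ (□ , _ , d , refl)
  ⇝-substitute _ bot Δ keep    = inj₁ (Δ , (λ _ → ⇝-refl) , refl)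
  ⇝-substitute {φ} lin (_•_ {χ} {δ} t u) Δ (r ⊙ s)
    with lχ , lδ , χ#δ ← AllPairs-++⁻ (vars χ) lin
    with ⇝-substitute lχ t Δ r | ⇝-substitute lδ u Δ s
  ... | inj₂ (C , Θ , d , refl) | _ = inj₂ (C ⊙ˡ _ , Θ , d , refl)
  ... | inj₁ _ | inj₂ (C , Θ , d , refl) = inj₂ (_ ⊙ʳ C , Θ , d , refl)
  ... | inj₁ (Δ₁ , r₁ , refl) | inj₁ (Δ₂ , r₂ , refl) =
    inj₁ (Ξ , Δ⇝Ξ , cong₂ _⊙_
      (substitute-cong χ (glue-∈ {vars χ} {Δ₁} {Δ₂}))
      (substitute-cong δ (glue-disjoint {vars χ} {vars δ} {Δ₁} {Δ₂} χ#δ)))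
    where
    Ξ : ℕ → Structure
    Ξ = glue (vars χ) Δ₁ Δ₂

    Δ⇝Ξ : ∀ p → Δ p ⇝⟨ φ ⟩ Ξ p
    Δ⇝Ξ p with p ∈? vars χ
    ... | yes _ = r₁ p
    ... | no  _ = r₂ p

  -- No linearity is needed here: all copies of a variable of χ receive the
  -- same replacement.
  ⇝-substitute⁺ : ∀ χ {Δ Δ′ : ℕ → Structure} → (∀ p → Δ p ⇝⟨ φ ⟩ Δ′ p) →
    substitute χ Δ ⇝⟨ φ ⟩ substitute χ Δ′
  ⇝-substitute⁺ (var p) r = r p
  ⇝-substitute⁺ top     r = keep
  ⇝-substitute⁺ bot     r = keep
  ⇝-substitute⁺ (χ • δ) r = ⇝-substitute⁺ χ r ⊙ ⇝-substitute⁺ δ r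

  -- Mix elimination

  -- Mix on φ, at arbitrarily many occurrences, with a left premise for each.
  Mix : Formula → Set ℓ
  Mix φ = ∀ {Γ Γ′ ψ} → Ψ ∣ Γ ⊢ ψ → Γ ⇝⟨ φ ⟩ Γ′ → Ψ ∣ Γ′ ⊢ ψ

  -- Mix on the immediate subformulas of φ.
  MixSub : Formula → Set ℓ
  MixSub (var _) = ⊤
  MixSub top     = ⊤
  MixSub bot     = ⊤
  MixSub (φ ∧ ψ) = Mix φ × Mix ψ
  MixSub (φ ∨ ψ) = Mix φ × Mix ψ
  MixSub (φ ⇒ ψ) = Mix φ × Mix ψ
  MixSub (φ • ψ) = Mix φ × Mix ψ
  MixSub (φ ⇐ ψ) = Mix φ × Mix ψ

  module _ (linear : ∀ σ → Ψ σ → Linear (ant σ))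
           (topFree : ∀ σ → Ψ σ → TopFree (ant σ)) where

    -- Induction on the right premise. Where φ is principal, d′ and e′ are the
    -- premises of the rule with all the non-principal occurrences replaced, and
    -- f : Δ ⊢ φ is the derivation attached to the principal one.
    mix-step : MixSub φ → Mix φ
    mix-step ih ax (hit d) = d
    mix-step ih ax keep    = ax
    mix-step ih ⊤R r = ⊤R
    mix-step ih (⊥L Γ) r with unplug Γ r
    ... | plugged Γ′ _ (hit d) = absurd Γ′ d
    ... | plugged Γ′ _ keep    = ⊥L Γ′
    mix-step ih (⇒L Γ d e) r with unplug Γ r
    ... | plugged Γ′ c (s ⊙ keep) =
      ⇒L Γ′ (mix-step ih d s) (mix-step ih e (c keep))
    mix-step ih@(mixφ , mixψ) (⇒L Γ d e) r
      | plugged Γ′ c (_⊙_ {Γ′ = Θ} s (hit f)) =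
      left-commute-∘ Γ′ (Θ ⊙ʳ □) (λ where
        ax     → ⇒L Γ′ d′ e′
        (⇒R g) → mixψ e′ (⇝-plug Γ′ (hit (mixφ g (hit d′ ⊙ ⇝-refl))))) f
      where
      d′ = mix-step ih d s
      e′ = mix-step ih e (c keep)
    mix-step ih (⇒R d) r = ⇒R (mix-step ih d (keep ⊙ r))
    mix-step ih (⇐L Γ d e) r with unplug Γ r
    ... | plugged Γ′ c (keep ⊙ s) =
      ⇐L Γ′ (mix-step ih d (c keep)) (mix-step ih e s)
    mix-step ih@(mixφ , mixψ) (⇐L Γ d e) r
      | plugged Γ′ c (_⊙_ {Δ′ = Θ} (hit f) s) =
      left-commute-∘ Γ′ (□ ⊙ˡ Θ) (λ where
        ax     → ⇐L Γ′ d′ e′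
        (⇐R g) → mixφ d′ (⇝-plug Γ′ (hit (mixψ g (⇝-refl ⊙ hit e′))))) f
      where
      d′ = mix-step ih d (c keep)
      e′ = mix-step ih e s
    mix-step ih (⇐R d) r = ⇐R (mix-step ih d (r ⊙ keep))
    mix-step ih (•L Γ d) r with unplug Γ r
    ... | plugged Γ′ c keep = •L Γ′ (mix-step ih d (c (keep ⊙ keep)))
    mix-step ih@(mixφ , mixψ) (•L Γ d) r | plugged Γ′ c (hit f) =
      left-commute Γ′ (λ where
        ax       → •L Γ′ d′
        (•R g h) → mixψ (mixφ d′ (⇝-plug Γ′ (hit g ⊙ keep)))
                        (⇝-plug Γ′ (⇝-refl ⊙ hit h))) f
      where d′ = mix-step ih d (c (keep ⊙ keep))
    mix-step ih (•R d e) (r ⊙ s) = •R (mix-step ih d r) (mix-step ih e s)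
    mix-step ih (∧L Γ d) r with unplug Γ r
    ... | plugged Γ′ c keep = ∧L Γ′ (mix-step ih d (c (keep ⊼ keep)))
    mix-step ih@(mixφ , mixψ) (∧L Γ d) r | plugged Γ′ c (hit f) =
      left-commute Γ′ (λ where
        ax       → ∧L Γ′ d′
        (∧R g h) → mixψ (mixφ d′ (⇝-plug Γ′ (hit g ⊼ keep)))
                        (⇝-plug Γ′ (⇝-refl ⊼ hit h))) f
      where d′ = mix-step ih d (c (keep ⊼ keep))
    mix-step ih (∧R d e) (r ⊼ s) = ∧R (mix-step ih d r) (mix-step ih e s)
    mix-step ih (∨L Γ d e) r with unplug Γ r
    ... | plugged Γ′ c keep =
      ∨L Γ′ (mix-step ih d (c keep)) (mix-step ih e (c keep))
    mix-step ih@(mixφ , mixψ) (∨L Γ d e) r | plugged Γ′ c (hit f) =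
      left-commute Γ′ (λ where
        ax      → ∨L Γ′ d′ e′
        (∨R₁ g) → mixφ d′ (⇝-plug Γ′ (hit g))
        (∨R₂ g) → mixψ e′ (⇝-plug Γ′ (hit g))) f
      where
      d′ = mix-step ih d (c keep)
      e′ = mix-step ih e (c keep)
    mix-step ih (∨R₁ d) r = ∨R₁ (mix-step ih d r)
    mix-step ih (∨R₂ d) r = ∨R₂ (mix-step ih d r)
    mix-step ih (⊼-contract Γ d) r with unplug Γ r
    ... | plugged Γ′ c s = ⊼-contract Γ′ (mix-step ih d (c (s ⊼ s)))
    mix-step ih (⊼-weaken Γ d) r with unplug Γ r
    ... | plugged Γ′ c (_ ⊼ s) = ⊼-weaken Γ′ (mix-step ih d (c s))
    mix-step ih (⊼-exchange Γ d) r with unplug Γ r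
    ... | plugged Γ′ c (s ⊼ t) = ⊼-exchange Γ′ (mix-step ih d (c (t ⊼ s)))
    mix-step ih (⊼-assoc Γ d) r with unplug Γ r
    ... | plugged Γ′ c (s ⊼ (t ⊼ u)) =
      ⊼-assoc Γ′ (mix-step ih d (c ((s ⊼ t) ⊼ u)))
    mix-step ih (⊙σ Γ {σ} σ∈Ψ Δ d) r with unplug Γ r
    ... | plugged Γ′ c s
      with ⇝-substitute (linear σ σ∈Ψ) (topFree σ σ∈Ψ) Δ s
    ... | inj₁ (Δ′ , Δ⇝Δ′ , refl) =
      ⊙σ Γ′ σ∈Ψ Δ′ (mix-step ih d (c (⇝-substitute⁺ (suc σ) Δ⇝Δ′)))
    ... | inj₂ (C , Θ , e , refl) = ∘-elim Γ′ C (absurd (Γ′ ∘ C) e)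

    mix : ∀ φ → Mix φ
    mix (var _) = mix-step tt
    mix top     = mix-step tt
    mix bot     = mix-step tt
    mix (φ ∧ ψ) = mix-step {φ ∧ ψ} (mix φ , mix ψ)
    mix (φ ∨ ψ) = mix-step {φ ∨ ψ} (mix φ , mix ψ)
    mix (φ ⇒ ψ) = mix-step {φ ⇒ ψ} (mix φ , mix ψ)
    mix (φ • ψ) = mix-step {φ • ψ} (mix φ , mix ψ)
    mix (φ ⇐ ψ) = mix-step {φ ⇐ ψ} (mix φ , mix ψ)

theorem13 : {ℓ : Level} (Ψ : Pred Sequent• ℓ) →
    (∀ σ → Ψ σ → Linear (ant σ)) →
    (∀ σ → Ψ σ → TopFree (ant σ)) →
    MixAdmissible Ψ
theorem13 Ψ linear topFree Γ Δ φ ψ _ d e =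
  mix Ψ linear topFree φ e (⇝-fill Ψ Γ d)
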